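{- If $\mathfrak{s}<\mathfrak{b}$, then $\mathfrak{s}=\mathfrak{s}_{\omega,\omega}$. Consequently, if $\mathfrak{s}<\mathfrak{b}$, then there is a weakly tight family $\mathscr{A}\subset[\omega]^{\omega}$ of size $\mathfrak{c}$.
   Context: We work in ZFC. $[\omega]^{\omega}$ is the set of infinite subsets of $\omega$, $\mathfrak{c}=2^{\aleph_0}$, $\bar e = \omega\setminus e$ for $e \subset \omega$, and $\exists^{\infty} n$ means "for infinitely many $n\in\omega$". $\mathfrak{b}$ is the bounding number (least size of an unbounded family in $\omega^{\omega}$ under eventual domination). $\mathfrak{s}$ is the splitting number: the least size of a family $\{e_\alpha:\alpha<\kappa\}\subset[\omega]^{\omega}$ such that for every $b\in[\omega]^{\omega}$ there is $\alpha$ with $|b\cap e_\alpha|=|b\cap\bar e_\alpha|=\omega$. $\mathfrak{s}_{\omega,\omega}$ is the least cardinal $\kappa$ such that there is a family $\{e_\alpha : \alpha<\kappa\}\subset[\omega]^{\omega}$ such that for any collection $\{b_n : n\in\omega\}\subset[\omega]^{\omega}$ there exists $\alpha<\kappa$ with $\exists^{\infty} n\in\omega\,(|b_n\cap e_\alpha|=\omega)$ and $\exists^{\infty} n\in\omega\,(|b_n\cap \bar e_\alpha|=\omega)$. A family $\mathscr{A}\subset[\omega]^{\omega}$ is almost disjoint (a.d.) if any two distinct members have finite intersection. $\mathcal{I}(\mathscr{A})$ is the ideal on $\omega$ generated by $\mathscr{A}$ (ideals on $\omega$ contain all finite sets, so $x\in\mathcal{I}(\mathscr{A})$ iff $x\setminus\bigcup\mathcal{F}$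 is finite for some finite $\mathcal{F}\subset\mathscr{A}$), and $\mathcal{I}^{+}(\mathscr{A})=\mathcal{P}(\omega)\setminus\mathcal{I}(\mathscr{A})$. An a.d. family $\mathscr{A}\subset[\omega]^{\omega}$ is weakly tight if for every countable collection $\{b_n : n\in\omega\}\subset\mathcal{I}^{+}(\mathscr{A})$ there is $a\in\mathscr{A}$ such that $\exists^{\infty} n\in\omega\,(|b_n\cap a|=\omega)$. -}

module Defs where

open import Data.Bool.Base using (Bool; T)
open import Data.List.Base using (List)
open import Data.List.Relation.Unary.All using (All)
open import Data.List.Relation.Unary.Any using (Any)
open import Data.Nat.Base using (ℕ; _≤_; _<_)
open import Data.Product.Base using (∃-syntax; Σ-syntax; _×_)
open import Function.Bundles using (_↣_; _⇔_)
open import Function.Definitions using (Injective)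
open import Level using (0ℓ)
open import Relation.Binary.PropositionalEquality.Core using (_≡_; _≢_)
open import Relation.Nullary.Negation.Core using (¬_)
open import Relation.Unary using (Pred; _∈_; _∉_; _⊆_; _∩_; ∁)

-- The power set of ω, as characteristic functions.  Everything here is meant
-- to be read under excluded middle, where every predicate on ℕ has one.  This
-- choice makes the power set small, and under function extensionality _≡_ on
-- it is equality of sets.
𝒫ω : Set
𝒫ω = ℕ → Bool

⟦_⟧ : 𝒫ω → Pred ℕ 0ℓ
⟦ x ⟧ n = T (x n)

∃∞ : Pred (Pred ℕ 0ℓ) 0ℓ
∃∞ P = ∀ m → ∃[ n ] (m ≤ n × P n)

Infinite : Pred (Pred ℕ 0ℓ) 0ℓ
Infinite P = ∃∞ λ n → n ∈ P

Finite : Pred (Pred ℕ 0ℓ) 0ℓ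
Finite P = ∃[ m ] (∀ n → n ∈ P → n < m)

[ω]^ω : Pred 𝒫ω 0ℓ
[ω]^ω x = Infinite ⟦ x ⟧

-- Cardinals are represented by types of that size; a cardinal is determined
-- only up to bijection.

_≼_ : Set → Set → Set
κ ≼ ι = κ ↣ ι

_≺_ : Set → Set → Set
κ ≺ ι = κ ≼ ι × ¬ (ι ≼ κ)

-- "κ is the least cardinal with property P".
IsLeast : (Set → Set) → Set → Set₁
IsLeast P κ = P κ × (∀ ι → P ι → κ ≼ ι)

𝔠 : Set
𝔠 = ℕ → Bool

_≤*_ : (ℕ → ℕ) → (ℕ → ℕ) → Set
f ≤* g = ∃[ m ] (∀ n → m ≤ n → f n ≤ g n)

Unbounded : {κ : Set} → (κ → ℕ → ℕ) → Set
Unbounded f = ¬ (∃[ g ] (∀ α → f α ≤* g))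

Is-𝔟 : Set → Set₁
Is-𝔟 = IsLeast λ κ → Σ[ f ∈ (κ → ℕ → ℕ) ] Unbounded f

Splitting : {κ : Set} → (κ → 𝒫ω) → Set
Splitting e =
  ∀ b → b ∈ [ω]^ω →
  ∃[ α ] (Infinite (⟦ b ⟧ ∩ ⟦ e α ⟧) × Infinite (⟦ b ⟧ ∩ ∁ ⟦ e α ⟧))

Is-𝔰 : Set → Set₁
Is-𝔰 = IsLeast λ κ →
  Σ[ e ∈ (κ → 𝒫ω) ] ((∀ α → e α ∈ [ω]^ω) × Splitting e)

ωω-Splitting : {κ : Set} → (κ → 𝒫ω) → Set
ωω-Splitting e =
  ∀ (b : ℕ → 𝒫ω) → (∀ n → b n ∈ [ω]^ω) →
  ∃[ α ] ((∃∞ λ n → Infinite (⟦ b n ⟧ ∩ ⟦ e α ⟧)) ×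
          (∃∞ λ n → Infinite (⟦ b n ⟧ ∩ ∁ ⟦ e α ⟧)))

Is-𝔰ωω : Set → Set₁
Is-𝔰ωω = IsLeast λ κ →
  Σ[ e ∈ (κ → 𝒫ω) ] ((∀ α → e α ∈ [ω]^ω) × ωω-Splitting e)

AlmostDisjoint : Pred 𝒫ω 0ℓ → Set
AlmostDisjoint 𝒜 = ∀ x y → x ∈ 𝒜 → y ∈ 𝒜 → x ≢ y → Finite (⟦ x ⟧ ∩ ⟦ y ⟧)

⋃ : List 𝒫ω → Pred ℕ 0ℓ
⋃ F n = Any (λ a → n ∈ ⟦ a ⟧) F

𝓘 : Pred 𝒫ω 0ℓ → Pred 𝒫ω 0ℓ
𝓘 𝒜 x = ∃[ F ] (All (_∈ 𝒜) F × Finite (⟦ x ⟧ ∩ ∁ (⋃ F)))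

WeaklyTight : Pred 𝒫ω 0ℓ → Set
WeaklyTight 𝒜 =
  𝒜 ⊆ [ω]^ω × AlmostDisjoint 𝒜 ×
  (∀ (b : ℕ → 𝒫ω) → (∀ n → b n ∉ 𝓘 𝒜) →
   ∃[ a ] (a ∈ 𝒜 × ∃∞ λ n → Infinite (⟦ b n ⟧ ∩ ⟦ a ⟧)))

-- An explicit enumeration, rather than a bijection with the type ∃ 𝒜, because
-- 𝒜 need not be proof-irrelevant.
HasSize : Pred 𝒫ω 0ℓ → Set → Set
HasSize 𝒜 κ =
  Σ[ f ∈ (κ → 𝒫ω) ] (Injective _≡_ _≡_ f × (∀ x → x ∈ 𝒜 ⇔ (∃[ α ] f α ≡ x)))

{-# OPTIONS --safe #-}
module Submission where

open import Defs
open import Axiom.ExcludedMiddle using (ExcludedMiddle)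
open import Axiom.Extensionality.Propositional using (Extensionality)
open import Data.Bool.Base using (Bool; true; false; T; not; if_then_else_)
open import Data.Bool.Properties using (T?; T-irrelevant; not-¬)
open import Data.Empty using (⊥-elim)
open import Data.List.Base using (List; []; _∷_; map)
open import Data.List.Membership.Propositional using (lose) renaming (_∈_ to _∈ˡ_)
open import Data.List.Relation.Unary.All using (All; []; _∷_)
open import Data.List.Relation.Unary.Any using (Any; here; there)
open import Data.List.Relation.Unary.Any.Properties using (map⁺)
open import Data.Maybe.Base using (Maybe; just; nothing)
open import Data.Maybe.Properties using (just-injective)
open import Data.Nat.Base using (ℕ; zero; suc; _+_; _⊔_; _≤_; _<_; z≤n; s≤s)
open import Data.Nat.Properties
open import Data.Product.Base using (_×_; _,_; Σ; Σ-syntax; ∃; ∃-syntax; proj₁; proj₂)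
open import Data.Sum.Base using (_⊎_; inj₁; inj₂; [_,_]′)
open import Data.Sum.Properties using (inj₂-injective)
open import Function.Base using (_∘_; id; const)
open import Function.Bundles using (mk⇔)
open import Function.Definitions using (Injective)
open import Induction.WellFounded using (Acc; acc; WellFounded)
open import Level using (0ℓ)
open import Relation.Binary.PropositionalEquality
open import Relation.Nullary.Decidable using (Dec; yes; no; ⌊_⌋; toWitness; fromWitness)
open import Relation.Nullary.Negation using (¬_; contradiction)
open import Relation.Unary using (Pred; _∈_; _∉_; _⊆_; _∩_; ∁)

-- If e is a splitting family indexed by 𝔰 and (b n) witnesses that it is not
-- (ω,ω)-splitting, then for each α almost all b n lie almost inside one side
-- of e α; a function dominating the 𝔰 many bounds selects a point from each
-- b n, and the infinite set of these points is split by no e α.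
--
-- The weakly tight family is built by recursion of length 𝔠.  Given a sequence
-- of infinite sets, split it at the least η for which e η (ω,ω)-splits it, pass
-- to either half, and repeat.  Each of the 2^ω branches decides a side of e η
-- for all η in an initial segment of 𝔰; call this partial function its node.
-- Different branches have incompatible nodes.  Every member of the family
-- carries countably many nodes, and a set that is almost disjoint from one
-- decided side of each of them is almost disjoint from the member.  As fewer
-- than 𝔠 nodes occur at a given stage, some branch has a node contained in none
-- of them.  A set following this branch is almost disjoint from every member
-- whose nodes all disagree with it; the other members have a node that is a
-- restriction of the new one, so there are fewer than 𝔟 of them and they are
-- avoided by domination.  Following a branch inside each b n gives x n ⊆ b n,
-- and following one for the sequence (x n) gives the new member, which meets
-- infinitely many b n.

-- Almost all, infinitely many, and finite sets

∀∞ : Pred (Pred ℕ 0ℓ) 0ℓ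
∀∞ P = ∃[ m ] (∀ n → m ≤ n → P n)

∀∞-map : {P Q : Pred ℕ 0ℓ} → (∀ {n} → P n → Q n) → ∀∞ P → ∀∞ Q
∀∞-map P⇒Q (m , p) = m , λ n m≤n → P⇒Q (p n m≤n)

∀∞-zip : {P Q R : Pred ℕ 0ℓ} → (∀ {n} → P n → Q n → R n) → ∀∞ P → ∀∞ Q → ∀∞ R
∀∞-zip f (m , p) (m′ , q) =
  m ⊔ m′ , λ n le → f (p n (≤-trans (m≤m⊔n m m′) le)) (q n (≤-trans (m≤n⊔m m m′) le))

∃∞-∀∞ : {P Q R : Pred ℕ 0ℓ} → (∀ {n} → P n → Q n → R n) → ∃∞ P → ∀∞ Q → ∃∞ R
∃∞-∀∞ f p (m , q) k with p (m ⊔ k)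
... | n , le , pn = n , ≤-trans (m≤n⊔m m k) le , f pn (q n (≤-trans (m≤m⊔n m k) le))

∃∞-map : {P Q : Pred ℕ 0ℓ} → (∀ {n} → P n → Q n) → ∃∞ P → ∃∞ Q
∃∞-map P⇒Q p m with p m
... | n , le , pn = n , le , P⇒Q pn

Finite⇒∀∞∁ : {P : Pred ℕ 0ℓ} → Finite P → ∀∞ (∁ P)
Finite⇒∀∞∁ (m , p) = m , λ n m≤n Pn → <⇒≱ (p n Pn) m≤n

∀∞∁⇒Finite : {P : Pred ℕ 0ℓ} → ∀∞ (∁ P) → Finite P
∀∞∁⇒Finite (m , p) = m , λ n Pn → ≰⇒> λ m≤n → p n m≤n Pn

Finite⇒¬Infinite : {P : Pred ℕ 0ℓ} → Finite P → ¬ Infinite P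
Finite⇒¬Infinite (m , p) inf with inf m
... | n , m≤n , Pn = <⇒≱ (p n Pn) m≤n

Finite-⊆ : {P Q : Pred ℕ 0ℓ} → P ⊆ Q → Finite Q → Finite P
Finite-⊆ P⊆Q (m , q) = m , λ n Pn → q n (P⊆Q Pn)

Finite-∅ : {P : Pred ℕ 0ℓ} → (∀ n → n ∉ P) → Finite P
Finite-∅ empty = 0 , λ n Pn → contradiction Pn (empty n)

Finite-∪ : {P Q R : Pred ℕ 0ℓ} → (∀ n → n ∈ R → n ∈ P ⊎ n ∈ Q) → Finite P → Finite Q → Finite R
Finite-∪ {P} {Q} {R} R⊆ (m , p) (m′ , q) = m ⊔ m′ , λ n Rn →
  [ (λ Pn → <-≤-trans (p n Pn) (m≤m⊔n m m′)) , (λ Qn → <-≤-trans (q n Qn) (m≤n⊔m m m′)) ]′ (R⊆ n Rn)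

Infinite-∖ : {P Q R : Pred ℕ 0ℓ} → (∀ {n} → n ∈ P → n ∉ Q → n ∈ R) →
             Infinite P → Finite (P ∩ Q) → Infinite R
Infinite-∖ {P} {Q} {R} f inf fin =
  ∃∞-∀∞ {P} {∁ (P ∩ Q)} {R} (λ Pn ¬PQ → f Pn (λ Qn → ¬PQ (Pn , Qn))) inf (Finite⇒∀∞∁ fin)

Finite-⋃< : (P : ℕ → Pred ℕ 0ℓ) → (∀ k → Finite (P k)) →
            ∀ K → Finite (λ n → ∃[ k ] (k < K × n ∈ P k))
Finite-⋃< P fin zero = Finite-∅ λ { _ (_ , () , _) }
Finite-⋃< P fin (suc K) = Finite-∪ {P = P K} split (fin K) (Finite-⋃< P fin K)
  where
  split : ∀ n → ∃[ k ] (k < suc K × n ∈ P k) → n ∈ P K ⊎ ∃[ k ] (k < K × n ∈ P k)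
  split n (k , s≤s k≤K , Pkn) with m≤n⇒m<n∨m≡n k≤K
  ... | inj₁ k<K = inj₂ (k , k<K , Pkn)
  ... | inj₂ refl = inj₁ Pkn

Finite-⋃ : (P : ℕ → Pred ℕ 0ℓ) → (∀ k → Finite (P k)) → ∀∞ (λ k → ∀ n → n ∉ P k) →
           Finite (λ n → ∃[ k ] n ∈ P k)
Finite-⋃ P fin (K , empty) = Finite-⊆ below-K (Finite-⋃< P fin K)
  where
  below-K : ∀ {n} → ∃[ k ] n ∈ P k → ∃[ k ] (k < K × n ∈ P k)
  below-K {n} (k , Pkn) = k , ≰⇒> (λ K≤k → empty k K≤k n Pkn) , Pkn

-- Sides of a set, nodes, and refinement of sequences

side : Bool → 𝒫ω → Pred ℕ 0ℓ
side true  x = ⟦ x ⟧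
side false x = ∁ ⟦ x ⟧

side-total : ∀ i x n → n ∈ side i x ⊎ n ∈ side (not i) x
side-total i x n with i | T? (x n)
... | true  | yes p = inj₁ p
... | true  | no ¬p = inj₂ ¬p
... | false | yes p = inj₂ p
... | false | no ¬p = inj₁ ¬p

side-disjoint : ∀ i x {n} → n ∈ side i x → n ∉ side (not i) x
side-disjoint true  x p ¬p = ¬p p
side-disjoint false x ¬p p = ¬p p

Node : Set → Set
Node κ = κ → Maybe Bool

_⊑ᴺ_ : {κ : Set} → Node κ → Node κ → Set
σ ⊑ᴺ τ = ∀ η i → σ η ≡ just i → τ η ≡ just i

Seq : Set
Seq = Σ[ X ∈ (ℕ → 𝒫ω) ] (∀ n → X n ∈ [ω]^ω)

-- The index `m` need only be at least `n`; it may repeat. This suffices to carry over whatever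
-- holds for almost all terms and passes to subsets.
record _⊑ˢ_ (Y X : Seq) : Set where
  constructor refines
  field
    refine : ∀ n → ∃[ m ] (n ≤ m × ⟦ proj₁ Y n ⟧ ⊆ ⟦ proj₁ X m ⟧)

open _⊑ˢ_

⊑ˢ-refl : ∀ {X} → X ⊑ˢ X
⊑ˢ-refl = refines λ n → n , ≤-refl , id

⊑ˢ-trans : ∀ {X Y Z} → Z ⊑ˢ Y → Y ⊑ˢ X → Z ⊑ˢ X
⊑ˢ-trans Z⊑Y Y⊑X = refines λ n →
  let m , n≤m , Z⊆Y = refine Z⊑Y n
      l , m≤l , Y⊆X = refine Y⊑X m
  in l , ≤-trans n≤m m≤l , Y⊆X ∘ Z⊆Y

∀∞Finite-⊑ˢ : ∀ {X Y} {Q : Pred ℕ 0ℓ} → Y ⊑ˢ X →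
              ∀∞ (λ n → Finite (⟦ proj₁ X n ⟧ ∩ Q)) → ∀∞ (λ n → Finite (⟦ proj₁ Y n ⟧ ∩ Q))
∀∞Finite-⊑ˢ Y⊑X (k , fin) = k , λ n k≤n → let m , n≤m , Y⊆X = refine Y⊑X n in
  Finite-⊆ (λ (p , q) → Y⊆X p , q) (fin m (≤-trans k≤n n≤m))

-- A pairing function

antidiagonal-next : ℕ × ℕ → ℕ × ℕ
antidiagonal-next (zero  , i) = suc i , 0
antidiagonal-next (suc n , i) = n , suc i

unpair : ℕ → ℕ × ℕ
unpair zero    = 0 , 0
unpair (suc k) = antidiagonal-next (unpair k)

unpair-surjective : ∀ n i → ∃[ k ] unpair k ≡ (n , i)
unpair-surjective n i = go (n + i) n i refl
  where
  go : ∀ s n i → n + i ≡ s → ∃[ k ] unpair k ≡ (n , i)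
  go zero    zero zero _ = 0 , refl
  go (suc s) (suc n) zero eq with go s 0 n (suc-injective (trans (cong suc (sym (+-identityʳ n))) eq))
  ... | k , e = suc k , cong antidiagonal-next e
  go (suc s) n (suc i) eq with go (suc s) (suc n) i (trans (sym (+-suc n i)) eq)
  ... | k , e = suc k , cong antidiagonal-next e

pair : ℕ → ℕ → ℕ
pair n i = proj₁ (unpair-surjective n i)

unpair-pair : ∀ n i → unpair (pair n i) ≡ (n , i)
unpair-pair n i = proj₂ (unpair-surjective n i)

pair-≥ : ∀ n i → i ≤ pair n i
pair-≥ n i = subst (λ p → proj₂ p ≤ pair n i) (unpair-pair n i) (proj₂-unpair (pair n i))
  where
  proj₂-next : ∀ p → proj₂ (antidiagonal-next p) ≤ suc (proj₂ p)
  proj₂-next (zero  , i) = z≤n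
  proj₂-next (suc n , i) = ≤-refl
  proj₂-unpair : ∀ k → proj₂ (unpair k) ≤ k
  proj₂-unpair zero    = z≤n
  proj₂-unpair (suc k) = ≤-trans (proj₂-next (unpair k)) (s≤s (proj₂-unpair k))

-- Index sets smaller than 𝔠 and smaller than 𝔟

Few : Set → Set
Few M = (φ : M → 𝔠) → ∃[ y ] (∀ m → φ m ≢ y)

Few-ℕ : Few ℕ
Few-ℕ φ = (λ n → not (φ n n)) , λ n eq → not-¬ refl (cong (λ y → y n) eq)

Bounded : Set → Set
Bounded K = (f : K → ℕ → ℕ) → ∃[ g ] (∀ α → f α ≤* g)

maxTo : (ℕ → ℕ) → ℕ → ℕ
maxTo f zero    = f 0
maxTo f (suc n) = maxTo f n ⊔ f (suc n)

≤-maxTo : ∀ f {c n} → c ≤ n → f c ≤ maxTo f n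
≤-maxTo f {n = zero} z≤n = ≤-refl
≤-maxTo f {n = suc n} c≤ with m≤n⇒m<n∨m≡n c≤
... | inj₁ (s≤s c≤n) = ≤-trans (≤-maxTo f c≤n) (m≤m⊔n _ _)
... | inj₂ refl      = m≤n⊔m (maxTo f n) _

-- For each `α` take the maximum of `f (α , c) n` over `c ≤ n`; as a function of `n` it bounds each
-- `f (α , c)` from `n = c` on.
Bounded-×ℕ : ∀ {K} → Bounded K → Bounded (K × ℕ)
Bounded-×ℕ bdd f with bdd (λ α n → maxTo (λ c → f (α , c) n) n)
... | g , dom = g , λ (α , c) → let m , le = dom α in
  m ⊔ c , λ n m⊔c≤n → ≤-trans (≤-maxTo (λ c → f (α , c) n) (≤-trans (m≤n⊔m m c) m⊔c≤n))
                                (le n (≤-trans (m≤m⊔n m c) m⊔c≤n))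

-- `↓` is Boolean so that comparisons are proof irrelevant and an element of an initial segment is
-- determined by its first component.
record WellOrder (A : Set) : Set where
  field
    ↓      : A → A → Bool

  _≺ʷ_ : A → A → Set
  x ≺ʷ y = T (↓ y x)

  field
    wf     : WellFounded _≺ʷ_
    trans≺ : ∀ {x y z} → x ≺ʷ y → y ≺ʷ z → x ≺ʷ z
    tri    : ∀ x y → x ≺ʷ y ⊎ x ≡ y ⊎ y ≺ʷ x

-- Consequences of excluded middle and extensionality

module Classical (em : ExcludedMiddle 0ℓ) (ext : Extensionality 0ℓ 0ℓ) where

  by-contradiction : {P : Set} → ¬ ¬ P → P
  by-contradiction {P} ¬¬p with em {P}
  ... | yes p = p
  ... | no ¬p = contradiction ¬p ¬¬p

  ¬∀⇒∃¬ : {A : Set} {P : A → Set} → ¬ (∀ x → P x) → ∃[ x ] ¬ P x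
  ¬∀⇒∃¬ ¬∀ = by-contradiction λ ¬∃ → ¬∀ λ x → by-contradiction λ ¬Px → ¬∃ (x , ¬Px)

  opaque
    char : {A : Set} → (A → Set) → A → Bool
    char P x = ⌊ em {P x} ⌋

    char⁺ : {A : Set} {P : A → Set} {x : A} → P x → T (char P x)
    char⁺ = fromWitness

    char⁻ : {A : Set} {P : A → Set} {x : A} → T (char P x) → P x
    char⁻ = toWitness

  ⊆-antisym : {A : Set} {U V : A → Bool} →
              (∀ x → T (U x) → T (V x)) → (∀ x → T (V x) → T (U x)) → U ≡ V
  ⊆-antisym {U = U} {V} U⊆V V⊆U = ext λ x → same (U⊆V x) (V⊆U x)
    where
    same : ∀ {a b} → (T a → T b) → (T b → T a) → a ≡ b
    same {true}  {true}  _ _ = refl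
    same {true}  {false} f _ = ⊥-elim (f _)
    same {false} {true}  _ g = ⊥-elim (g _)
    same {false} {false} _ _ = refl

  ¬∃∞⇒∀∞¬ : {P : Pred ℕ 0ℓ} → ¬ ∃∞ P → ∀∞ (∁ P)
  ¬∃∞⇒∀∞¬ ¬p with ¬∀⇒∃¬ ¬p
  ... | m , q = m , λ n m≤n Pn → q (n , m≤n , Pn)

  ¬Infinite⇒Finite : {P : Pred ℕ 0ℓ} → ¬ Infinite P → Finite P
  ¬Infinite⇒Finite = ∀∞∁⇒Finite ∘ ¬∃∞⇒∀∞¬

  ¬Finite⇒Infinite : {P : Pred ℕ 0ℓ} → ¬ Finite P → Infinite P
  ¬Finite⇒Infinite ¬fin = by-contradiction (¬fin ∘ ¬Infinite⇒Finite)

  -- The missed point is built by columns: its column `n` differs from column `n` of every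
  -- `φ (m , n)`.
  Few-×ℕ : ∀ {M} → Few M → Few (M × ℕ)
  Few-×ℕ few φ = (λ k → let n , i = unpair k in proj₁ (miss n) i) , λ (m , n) eq →
    proj₂ (miss n) m (ext λ i → trans (cong (λ y → y (pair n i)) eq)
      (cong (λ (n , i) → proj₁ (miss n) i) (unpair-pair n i)))
    where
    miss : ∀ n → ∃[ y ] (∀ m → (λ i → φ (m , n) (pair n i)) ≢ y)
    miss n = few λ m i → φ (m , n) (pair n i)

  Few-⊎ : ∀ {M N} → Few M → Few N → Few (M ⊎ N)
  Few-⊎ few few′ φ = (λ k → glue (unpair k)) , λ
    { (inj₁ m) eq → proj₂ miss₀ m (ext λ i → trans (cong (λ y → y (pair 0 i)) eq)
        (cong glue (unpair-pair 0 i)))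
    ; (inj₂ m) eq → proj₂ miss₁ m (ext λ i → trans (cong (λ y → y (pair 1 i)) eq)
        (cong glue (unpair-pair 1 i)))
    }
    where
    miss₀ = few λ m i → φ (inj₁ m) (pair 0 i)
    miss₁ = few′ λ m i → φ (inj₂ m) (pair 1 i)
    glue : ℕ × ℕ → Bool
    glue (zero  , i) = proj₁ miss₀ i
    glue (suc _ , i) = proj₁ miss₁ i

  -- `g` dominates, for every `α`, the function sending `k` to a bound of `P α k`; an infinite
  -- `P α k` gets the placeholder 0.
  dominate : ∀ {K} → Bounded K → (P : K → ℕ → Pred ℕ 0ℓ) →
             ∃[ g ] (∀ α → ∀∞ (λ k → Finite (P α k)) → ∀∞ λ k → ∀ n → g k ≤ n → n ∉ P α k)
  dominate bounded P = g , λ α fin → ∀∞-zip (λ {k} f → beyond f em) fin (dom α)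
    where
    bound : ∀ {α k} → Dec (Finite (P α k)) → ℕ
    bound (yes (m , _)) = m
    bound (no _)        = 0
    dominating = bounded λ α k → bound {α} {k} em
    g   = proj₁ dominating
    dom = proj₂ dominating
    beyond : ∀ {α k} → Finite (P α k) → (d : Dec (Finite (P α k))) → bound d ≤ g k →
             ∀ n → g k ≤ n → n ∉ P α k
    beyond _   (yes (m , below)) m≤g n g≤n Pn = <⇒≱ (below n Pn) (≤-trans m≤g g≤n)
    beyond fin (no infinite)                  = contradiction fin infinite

  -- Zermelo's well-ordering theorem

  -- A tower is a subset each of whose elements x is the chosen element outside
  -- some smaller tower; that tower is then the initial segment below x.

  module Zermelo (A : Set) where

    choose-outside : (U : A → Bool) → Dec (∃[ x ] ¬ T (U x)) → Maybe A
    choose-outside U (yes (x , _)) = just x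
    choose-outside U (no _)        = nothing

    next : (A → Bool) → Maybe A
    next U = choose-outside U em

    next-outside : ∀ U {x} → next U ≡ just x → ¬ T (U x)
    next-outside U = go em
      where
      go : ∀ d {x} → choose-outside U d ≡ just x → ¬ T (U x)
      go (yes (_ , x∉U)) refl = x∉U

    next-exists : ∀ U {x} → ¬ T (U x) → ∃[ y ] next U ≡ just y
    next-exists U {x} x∉U = go em
      where
      go : ∀ d → ∃[ y ] choose-outside U d ≡ just y
      go (yes (y , _)) = y , refl
      go (no full)     = contradiction (x , x∉U) full

    data Tower (U : A → Bool) : Set where
      tower : (S : ∀ x → T (U x) → A → Bool) →
              (∀ x p → Tower (S x p)) →
              (∀ x p y → T (S x p y) → T (U y)) →
              (∀ x p → next (S x p) ≡ just x) →
              Tower U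

    _⊑_ : (A → Bool) → (A → Bool) → Set
    U ⊑ V = ∀ x → T (U x) → T (V x)

    _⊏_ : (A → Bool) → (A → Bool) → Set
    U ⊏ V = U ⊑ V × ∃[ x ] (next U ≡ just x × T (V x))

    Comparable : (A → Bool) → (A → Bool) → Set
    Comparable U V = U ⊑ V ⊎ V ⊏ U

    next-unique : ∀ {U V x y} → U ≡ V → next U ≡ just x → next V ≡ just y → x ≡ y
    next-unique refl e e′ = just-injective (trans (sym e) e′)

    seg : ∀ {U} → Tower U → ∀ x → T (U x) → A → Bool
    seg (tower S _ _ _) = S

    seg-⊑ : ∀ {U} (tU : Tower U) x p → seg tU x p ⊑ U
    seg-⊑ (tower _ _ S⊑ _) = S⊑

    seg-next : ∀ {U} (tU : Tower U) x p → next (seg tU x p) ≡ just x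
    seg-next (tower _ _ _ S-next) = S-next

    -- Take `x` in `U` outside `V`, with segment `S`. Comparing `U` with the segments of `V` gives
    -- `V ⊑ U`. If `V ⊏ S`, then `V ⊏ U`; otherwise `V ≡ S`, so the point chosen after `V` is `x`,
    -- which lies in `U`. Comparisons of smaller towers are hypotheses, to be supplied by recursion.
    comparable : ∀ {U V} (tU : Tower U) (tV : Tower V) →
                 (∀ x p → Comparable (seg tU x p) V) →
                 (∀ y q → Comparable U (seg tV y q)) →
                 (∀ x p y q → Comparable (seg tU x p) (seg tV y q)) →
                 (∀ x p y q → Comparable (seg tV y q) (seg tU x p)) →
                 Comparable U V
    comparable {U} {V} tU tV S-V U-R S-R R-S with em {U ⊑ V}
    ... | yes U⊑V = inj₁ U⊑V
    ... | no  U⋢V with ¬∀⇒∃¬ U⋢V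
    ...   | x , x∉V′ = inj₂ (V⊏U (S-V x x∈U))
      where
      x∈U = by-contradiction λ x∉U → x∉V′ (⊥-elim ∘ x∉U)
      x∉V : ¬ T (V x)
      x∉V x∈V = x∉V′ (const x∈V)
      S = seg tU x x∈U
      V⊑U : V ⊑ U
      V⊑U y q with U-R y q
      ... | inj₁ U⊑R = contradiction (λ z p → seg-⊑ tV y q z (U⊑R z p)) U⋢V
      ... | inj₂ (_ , z , e , z∈U) = subst (T ∘ U) (next-unique refl e (seg-next tV y q)) z∈U
      V⊏U : Comparable S V → V ⊏ U
      V⊏U (inj₂ (_ , z , e , z∈S)) = V⊑U , z , e , seg-⊑ tU x x∈U z z∈S
      V⊏U (inj₁ S⊑V) = V⊑U , x , trans (cong next V≡S) (seg-next tU x x∈U) , x∈U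
        where
        -- Unless the segment `R` of `y` is strictly below `S`, which puts `y` into `S`, the point
        -- `x` would equal `y` or lie in `R`, hence in `V`.
        V⊑S : V ⊑ S
        V⊑S y q with S-R x x∈U y q | R-S x x∈U y q
        ... | inj₂ (_ , z , e , z∈S) | _ =
              subst (T ∘ S) (next-unique refl e (seg-next tV y q)) z∈S
        ... | inj₁ S⊑R | inj₁ R⊑S = contradiction (subst (T ∘ V) (sym x≡y) q) x∉V
          where
          x≡y = next-unique (⊆-antisym S⊑R R⊑S) (seg-next tU x x∈U) (seg-next tV y q)
        ... | inj₁ S⊑R | inj₂ (_ , z , e , z∈R) = contradiction (seg-⊑ tV y q x x∈R) x∉V
          where
          x∈R = subst (T ∘ seg tV y q) (next-unique refl e (seg-next tU x x∈U)) z∈R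
        V≡S = ⊆-antisym V⊑S S⊑V

    -- The two directions are proved together because each calls the other at smaller towers.
    linear : ∀ {U V} → Tower U → Tower V → Comparable U V × Comparable V U
    linear tU@(tower _ tS _ _) tV@(tower _ tR _ _) =
      comparable tU tV
        (λ x p → proj₁ (linear (tS x p) tV)) (λ y q → proj₁ (linear tU (tR y q)))
        (λ x p y q → proj₁ (linear (tS x p) (tR y q)))
        (λ x p y q → proj₂ (linear (tS x p) (tR y q))) ,
      comparable tV tU
        (λ y q → proj₂ (linear tU (tR y q))) (λ x p → proj₂ (linear (tS x p) tV))
        (λ y q x p → proj₂ (linear (tS x p) (tR y q)))
        (λ y q x p → proj₁ (linear (tS x p) (tR y q)))

    IsSegment : A → (A → Bool) → Set
    IsSegment x S = Tower S × next S ≡ just x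

    segment-unique : ∀ {x S R} → IsSegment x S → IsSegment x R → S ≡ R
    segment-unique {x} {S} {R} (tS , eS) (tR , eR) = ⊆-antisym
      (below eS eR (proj₁ (linear tS tR))) (below eR eS (proj₂ (linear tS tR)))
      where
      below : ∀ {S R} → next S ≡ just x → next R ≡ just x → Comparable S R → S ⊑ R
      below eS eR (inj₁ S⊑R) = S⊑R
      below {S} eS eR (inj₂ (_ , z , e , z∈S)) = contradiction
        (subst (T ∘ S) (next-unique refl e eR) z∈S) (next-outside S eS)

    segment-in : ∀ {U} → Tower U → ∀ {x} → T (U x) → ∃[ S ] (IsSegment x S × S ⊑ U)
    segment-in (tower S tS S⊑ S-next) {x} p = S x p , (tS x p , S-next x p) , S⊑ x p

    largest : A → Bool
    largest = char λ x → ∃[ S ] IsSegment x S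

    largest-tower : Tower largest
    largest-tower = tower
      (λ x p → proj₁ (char⁻ p))
      (λ x p → proj₁ (proj₂ (char⁻ p)))
      (λ x p y y∈S → char⁺ (let R , isR , _ = segment-in (proj₁ (proj₂ (char⁻ p))) y∈S in R , isR))
      (λ x p → proj₂ (proj₂ (char⁻ p)))

    -- If `x` had no segment, some point would be chosen outside `largest`; then `largest` would be
    -- the segment of that point, putting it into `largest`.
    segment : ∀ x → ∃[ S ] IsSegment x S
    segment x = by-contradiction λ none →
      let y , e = next-exists largest {x} (λ p → none (char⁻ p))
      in next-outside largest e (char⁺ (largest , largest-tower , e))

    initial : A → A → Bool
    initial x = proj₁ (segment x)

    ↓-⊑ : ∀ {U} → Tower U → ∀ {x} → T (U x) → initial x ⊑ U
    ↓-⊑ {U} tU {x} p with segment-in tU p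
    ... | S , isS , S⊑U = subst (_⊑ U) (segment-unique isS (proj₂ (segment x))) S⊑U

    accessible : ∀ {U} → Tower U → ∀ x → U ≡ initial x → Acc (λ y z → T (initial z y)) x
    accessible (tower S tS S⊑ S-next) x refl = acc λ {y} y≺x →
      accessible (tS y y≺x) y (segment-unique (tS y y≺x , S-next y y≺x) (proj₂ (segment y)))

    opaque
      wellOrder : WellOrder A
      wellOrder = record
        { ↓ = initial
        ; wf = λ x → accessible (proj₁ (proj₂ (segment x))) x refl
        ; trans≺ = λ {x} {y} {z} x≺y y≺z → ↓-⊑ (proj₁ (proj₂ (segment z))) y≺z x x≺y
        ; tri = tri
        }
        where
        tri : ∀ x y → T (initial y x) ⊎ x ≡ y ⊎ T (initial x y)
        tri x y with segment x | segment y
        ... | S , tS , eS | R , tR , eR with linear tS tR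
        ...   | inj₂ (_ , z , e , z∈S) , _ = inj₂ (inj₂ (subst (T ∘ S) (next-unique refl e eR) z∈S))
        ...   | _ , inj₂ (_ , z , e , z∈R) = inj₁ (subst (T ∘ R) (next-unique refl e eS) z∈R)
        ...   | inj₁ S⊑R , inj₁ R⊑S = inj₂ (inj₁ (next-unique (⊆-antisym S⊑R R⊑S) eS eR))

  -- Least elements and comparison of nodes

  module _ {A : Set} (W : WellOrder A) where
    open WellOrder W

    least : (P : A → Set) → ∃ P → ∃[ x ] (P x × (∀ y → y ≺ʷ x → ¬ P y))
    least P (x , Px) = go (wf x) Px
      where
      go : ∀ {x} → Acc _≺ʷ_ x → P x → ∃[ z ] (P z × (∀ y → y ≺ʷ z → ¬ P y))
      go {x} (acc rs) Px with em {∃[ y ] (y ≺ʷ x × P y)}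
      ... | yes (y , y≺x , Py) = go (rs y≺x) Py
      ... | no none = x , Px , λ y y≺x Py → none (y , y≺x , Py)

    Closed : Node A → Set
    Closed σ = ∀ {ζ η i} → ζ ≺ʷ η → σ η ≡ just i → ∃[ j ] σ ζ ≡ just j

    restrict : Node A → A → Node A
    restrict σ η ζ = if ↓ η ζ then σ ζ else nothing

    restrict-≡ : ∀ {σ τ} η → (∀ ζ → ζ ≺ʷ η → τ ζ ≡ σ ζ) → (∀ ζ → ¬ (ζ ≺ʷ η) → τ ζ ≡ nothing) →
                 τ ≡ restrict σ η
    restrict-≡ {σ} {τ} η inside outside = ext λ ζ → at ζ (inside ζ) (outside ζ)
      where
      at : ∀ ζ → (T (↓ η ζ) → τ ζ ≡ σ ζ) → (¬ T (↓ η ζ) → τ ζ ≡ nothing) → τ ζ ≡ restrict σ η ζ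
      at ζ in′ out with ↓ η ζ
      ... | true  = in′ _
      ... | false = out id

    -- Look at the least `η` where `σ` is defined and `τ` does not agree. Either `τ` has the other
    -- value there, or it is undefined at `η`; being closed, it is then undefined from `η` on, and
    -- it equals `σ` below.
    compare : ∀ {σ τ} → Closed σ → Closed τ → ¬ (σ ⊑ᴺ τ) →
              (∃[ η ] ∃[ i ] (σ η ≡ just i × τ η ≡ just (not i))) ⊎ (∃[ η ] τ ≡ restrict σ η)
    compare {σ} {τ} σ-closed τ-closed σ⋢τ with least Differ differ
      where
      Differ : A → Set
      Differ η = ∃[ i ] (σ η ≡ just i × τ η ≢ just i)
      differ : ∃ Differ
      differ = by-contradiction λ none → σ⋢τ λ η i e → by-contradiction λ ne → none (η , i , e , ne)
    ... | η , (i , σ≡ , τ≢) , min = go (τ η) refl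
      where
      other : ∀ {i j} → j ≢ i → j ≡ not i
      other {true}  {true}  j≢i = contradiction refl j≢i
      other {true}  {false} _   = refl
      other {false} {true}  _   = refl
      other {false} {false} j≢i = contradiction refl j≢i
      go : ∀ m → τ η ≡ m → (∃[ η ] ∃[ i ] (σ η ≡ just i × τ η ≡ just (not i))) ⊎ (∃[ η ] τ ≡ restrict σ η)
      go (just j) τ≡ = inj₁ (η , i , σ≡ , trans τ≡ (cong just (other λ j≡i → τ≢ (trans τ≡ (cong just j≡i)))))
      go nothing  τ≡ = inj₂ (η , restrict-≡ η inside outside)
        where
        inside : ∀ ζ → ζ ≺ʷ η → τ ζ ≡ σ ζ
        inside ζ ζ≺η with σ-closed ζ≺η σ≡
        ... | j , e = trans (by-contradiction λ ne → min ζ ζ≺η (j , e , ne)) (sym e)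
        undefined : ∀ {j} → τ η ≢ just j
        undefined e with trans (sym τ≡) e
        ... | ()
        outside′ : ∀ ζ → ¬ (ζ ≺ʷ η) → ∀ m → τ ζ ≡ m → m ≡ nothing
        outside′ ζ ζ⊀η nothing  e = refl
        outside′ ζ ζ⊀η (just j) e with tri ζ η
        ... | inj₁ ζ≺η        = contradiction ζ≺η ζ⊀η
        ... | inj₂ (inj₁ refl) = contradiction e undefined
        ... | inj₂ (inj₂ η≺ζ) = contradiction (proj₂ (τ-closed η≺ζ e)) undefined
        outside : ∀ ζ → ¬ (ζ ≺ʷ η) → τ ζ ≡ nothing
        outside ζ ζ⊀η = outside′ ζ ζ⊀η (τ ζ) refl

  -- From splitting to (ω,ω)-splitting

  module Settling {κ : Set} (e : κ → 𝒫ω) where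

    record Splits (X : Seq) (η : κ) : Set where
      constructor mkSplits
      field
        both : ∀ i → ∃∞ λ n → Infinite (⟦ proj₁ X n ⟧ ∩ side i (e η))

    -- `i` names the side that almost contains almost every term, hence `not i` in the formula.
    record Settles (X : Seq) (η : κ) (i : Bool) : Set where
      constructor mkSettles
      field
        eventually : ∀∞ λ n → Finite (⟦ proj₁ X n ⟧ ∩ side (not i) (e η))

    open Splits public
    open Settles public

    settles-⊑ˢ : ∀ {X Y η i} → Y ⊑ˢ X → Settles X η i → Settles Y η i
    settles-⊑ˢ Y⊑X (mkSettles s) = mkSettles (∀∞Finite-⊑ˢ Y⊑X s)

    ¬splits⇒settles : ∀ {X η} → ¬ Splits X η → ∃ (Settles X η)
    ¬splits⇒settles {X} {η} ¬s with ¬∀⇒∃¬ (¬s ∘ mkSplits)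
    ... | true  , ¬p = false , mkSettles (∀∞-map ¬Infinite⇒Finite (¬∃∞⇒∀∞¬ ¬p))
    ... | false , ¬p = true  , mkSettles (∀∞-map ¬Infinite⇒Finite (¬∃∞⇒∀∞¬ ¬p))

    settles⇒¬splits : ∀ {X η i} → Settles X η i → ¬ Splits X η
    settles⇒¬splits {i = i} (mkSettles (m , fin)) s with both s (not i) m
    ... | n , m≤n , inf = Finite⇒¬Infinite (fin n m≤n) inf

    settles-unique : ∀ {X η i j} → Settles X η i → Settles X η j → i ≡ j
    settles-unique {X} {η} = go _ _
      where
      clash : Settles X η true → ¬ Settles X η false
      clash s t with ∀∞-zip _,_ (eventually s) (eventually t)
      ... | m , fin = Finite⇒¬Infinite
        (Finite-∪ (λ n Xn → [ (λ p → inj₂ (Xn , p)) , (λ p → inj₁ (Xn , p)) ]′ (side-total true (e η) n))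
          (proj₁ (fin m ≤-refl)) (proj₂ (fin m ≤-refl))) (proj₂ X m)
      go : ∀ i j → Settles X η i → Settles X η j → i ≡ j
      go true  true  _ _ = refl
      go false false _ _ = refl
      go true  false s t = contradiction t (clash s)
      go false true  s t = contradiction s (clash t)

    splitting⇒ωω-splitting : Bounded κ → Splitting e → ωω-Splitting e
    splitting⇒ωω-splitting bounded split b inf = by-contradiction λ none →
      unsplit λ α → ¬splits⇒settles λ s → none (α , both s true , both s false)
      where
      unsplit : ¬ (∀ α → ∃ (Settles (b , inf) α))
      unsplit settled = go (split c c-inf)
        where
        bad : κ → ℕ → Pred ℕ 0ℓ
        bad α n = ⟦ b n ⟧ ∩ side (not (proj₁ (settled α))) (e α)
        g = proj₁ (dominate bounded bad)
        r : ℕ → ℕ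
        -- Beyond `n` so that `c` is infinite; beyond `g n` so that for each `α` almost all these
        -- points miss the bad side.
        r n = proj₁ (inf n (n ⊔ g n))
        c : 𝒫ω
        c = char λ m → ∃[ n ] m ≡ r n
        c-inf : c ∈ [ω]^ω
        c-inf m = r m , ≤-trans (m≤m⊔n m (g m)) (proj₁ (proj₂ (inf m (m ⊔ g m)))) , char⁺ (m , refl)
        c-fin : ∀ α → Finite (⟦ c ⟧ ∩ side (not (proj₁ (settled α))) (e α))
        c-fin α = Finite-⊆ (λ (p , q) → let n , eq = char⁻ p in n , eq , q)
          (Finite-⋃ (λ n m → m ≡ r n × m ∈ side (not (proj₁ (settled α))) (e α))
            (λ n → suc (r n) , λ { _ (refl , _) → ≤-refl })
            (∀∞-map (λ { {n} beyond m (refl , q) → let _ , le , r∈b = inf n (n ⊔ g n) in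
                beyond m (≤-trans (m≤n⊔m n (g n)) le) (r∈b , q) })
              (proj₂ (dominate bounded bad) α (eventually (proj₂ (settled α))))))
        go : ¬ (∃[ α ] (Infinite (⟦ c ⟧ ∩ ⟦ e α ⟧) × Infinite (⟦ c ⟧ ∩ ∁ ⟦ e α ⟧)))
        go (α , in-e , out-e) with proj₁ (settled α) | c-fin α
        ... | true  | fin = Finite⇒¬Infinite fin out-e
        ... | false | fin = Finite⇒¬Infinite fin in-e

  -- The tree of halvings of a sequence

  module Branching {κ : Set} (W : WellOrder κ) (e : κ → 𝒫ω) (split : ωω-Splitting e) where
    open WellOrder W
    open Settling e

    split-exists : ∀ X → ∃ (Splits X)
    split-exists (X , inf) with split X inf
    ... | α , p , q = α , mkSplits λ { true → p ; false → q }

    opaque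
      critical : Seq → κ
      critical X = proj₁ (least W (Splits X) (split-exists X))

      critical-splits : ∀ X → Splits X (critical X)
      critical-splits X = proj₁ (proj₂ (least W (Splits X) (split-exists X)))

      settled-below : ∀ X {η} → η ≺ʷ critical X → ∃ (Settles X η)
      settled-below X η≺ = ¬splits⇒settles
        (proj₂ (proj₂ (least W (Splits X) (split-exists X))) _ η≺)

    half : Seq → Bool → Seq
    half X i = (λ n → char (⟦ proj₁ X (index n) ⟧ ∩ side i (e (critical X)))) ,
               λ n → ∃∞-map char⁺ (proj₂ (proj₂ (both (critical-splits X) i n)))
      where
      index : ℕ → ℕ
      index n = proj₁ (both (critical-splits X) i n)

    half-⊑ˢ : ∀ X i → half X i ⊑ˢ X
    half-⊑ˢ X i = refines λ n →
      let m , n≤m , _ = both (critical-splits X) i n in m , n≤m , λ p → proj₁ (char⁻ p)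

    half-settles : ∀ X i → Settles (half X i) (critical X) i
    half-settles X i = mkSettles (0 , λ n _ → Finite-∅ λ m (p , q) →
      side-disjoint i (e (critical X)) (proj₂ (char⁻ p)) q)

    -- Whatever `X` settles below its critical index stays settled in the half, and the half settles
    -- that index too.
    critical-half : ∀ X i → critical X ≺ʷ critical (half X i)
    critical-half X i with tri (critical X) (critical (half X i))
    ... | inj₁ lt = lt
    ... | inj₂ (inj₁ eq) = contradiction
      (subst (Splits (half X i)) (sym eq) (critical-splits (half X i)))
      (settles⇒¬splits (half-settles X i))
    ... | inj₂ (inj₂ gt) = contradiction (critical-splits (half X i))
      (settles⇒¬splits (settles-⊑ˢ (half-⊑ˢ X i) (proj₂ (settled-below X gt))))

    module Tree (X : Seq) where

      stage : 𝔠 → ℕ → Seq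
      stage f zero    = X
      stage f (suc k) = half (stage f k) (f k)

      stage-⊑ˢ : ∀ f {k l} → k ≤ l → stage f l ⊑ˢ stage f k
      stage-⊑ˢ f {k} {l} k≤l with m≤n⇒m<n∨m≡n k≤l
      ... | inj₂ refl = ⊑ˢ-refl
      stage-⊑ˢ f {k} {suc l} _ | inj₁ (s≤s k≤l) =
        ⊑ˢ-trans (half-⊑ˢ (stage f l) (f l)) (stage-⊑ˢ f k≤l)

      -- A stage may happen to settle indices above its critical one. Counting only those below it
      -- keeps the domain of a node downward closed.
      Decided : 𝔠 → κ → Bool → Set
      Decided f η i = ∃[ k ] (η ≺ʷ critical (stage f k) × Settles (stage f k) η i)

      decided-unique : ∀ {f η i j} → Decided f η i → Decided f η j → i ≡ j
      decided-unique {f} (k , _ , s) (l , _ , t) = settles-unique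
        (settles-⊑ˢ (stage-⊑ˢ f (m≤m⊔n k l)) s) (settles-⊑ˢ (stage-⊑ˢ f (m≤n⊔m k l)) t)

      decision : ∀ f η → Dec (∃ (Decided f η)) → Maybe Bool
      decision f η (yes (i , _)) = just i
      decision f η (no _)        = nothing

      node : 𝔠 → Node κ
      node f η = decision f η em

      node-sound : ∀ {f η i} → node f η ≡ just i → Decided f η i
      node-sound {f} {η} = go em
        where
        go : ∀ d {i} → decision f η d ≡ just i → Decided f η i
        go (yes (_ , d)) refl = d

      node-complete : ∀ {f η i} → Decided f η i → node f η ≡ just i
      node-complete {f} {η} {i} d = go em
        where
        go : ∀ d → decision f η d ≡ just i
        go (yes (j , d′)) = cong just (decided-unique d′ d)
        go (no none)      = contradiction (i , d) none

      node-closed : ∀ f → Closed W (node f)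
      node-closed f {ζ} {η} ζ≺η eq with node-sound {f} {η} eq
      ... | k , η≺ , _ with settled-below (stage f k) (trans≺ ζ≺η η≺)
      ...   | j , s = j , node-complete (k , trans≺ ζ≺η η≺ , s)

      node-critical : ∀ f k → node f (critical (stage f k)) ≡ just (f k)
      node-critical f k = node-complete
        (suc k , critical-half (stage f k) (f k) , half-settles (stage f k) (f k))

      -- The branch can be read off from `τ`: each stage determines its critical index, and the
      -- value of `τ` there is the next turn.
      node-injective : ∀ {f g τ} → node f ⊑ᴺ τ → node g ⊑ᴺ τ → f ≡ g
      node-injective {f} {g} {τ} f⊑τ g⊑τ = ext λ k → agree k (stage-≡ k)
        where
        agree : ∀ k → stage f k ≡ stage g k → f k ≡ g k
        agree k eq = just-injective (trans (sym (f⊑τ _ _ (node-critical f k)))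
          (trans (cong (τ ∘ critical) eq) (g⊑τ _ _ (node-critical g k))))
        stage-≡ : ∀ k → stage f k ≡ stage g k
        stage-≡ zero    = refl
        stage-≡ (suc k) = cong₂ half (stage-≡ k) (agree k (stage-≡ k))

      -- A fusion: from index `k` on, its terms lie inside late terms of stage `k`, so it settles
      -- all that the node decides.
      diagonal : 𝔠 → Seq
      diagonal f = (λ k → proj₁ (stage f k) k) , λ k → proj₂ (stage f k) k

      diagonal-⊑ˢ : ∀ f → diagonal f ⊑ˢ X
      diagonal-⊑ˢ f = refines λ k → refine (stage-⊑ˢ f {0} {k} z≤n) k

      diagonal-settles : ∀ {f η i} → node f η ≡ just i → Settles (diagonal f) η i
      diagonal-settles {f} {η} eq with node-sound {f} {η} eq
      ... | k , _ , mkSettles (m , fin) = mkSettles (k ⊔ m , λ n le →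
        let l , n≤l , D⊆ = refine (stage-⊑ˢ f (≤-trans (m≤m⊔n k m) le)) n in
        Finite-⊆ (λ (p , q) → D⊆ p , q) (fin l (≤-trans (≤-trans (m≤n⊔m k m) le) n≤l)))

    -- Almost disjoint families with nodes

    Guards : (ℕ → Node κ) → 𝒫ω → Set
    Guards N a = ∀ (z : 𝒫ω) →
      (∀ n → ∃[ η ] ∃[ i ] (N n η ≡ just i × Finite (⟦ z ⟧ ∩ side i (e η)))) →
      Finite (⟦ z ⟧ ∩ ⟦ a ⟧)

    -- A node may be shared only by members with different codes, so only
    -- countably many members share it.
    record Family (J : Set) : Set where
      field
        set      : J → 𝒫ω
        nodes    : J → ℕ → Node κ
        code     : J → ℕ
        closed   : ∀ j n → Closed W (nodes j n)
        guards   : ∀ j → Guards (nodes j) (set j)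
        disjoint : ∀ {j j′} → j ≢ j′ → Finite (⟦ set j ⟧ ∩ ⟦ set j′ ⟧)
        unique   : ∀ {j j′ n n′} → code j ≡ code j′ → nodes j n ≡ nodes j′ n′ → j ≡ j′

    opaque
      ⋃ω : (ℕ → 𝒫ω) → 𝒫ω
      ⋃ω t = char λ n → ∃[ k ] n ∈ ⟦ t k ⟧

      ∈⋃ω⁺ : ∀ {t n} k → n ∈ ⟦ t k ⟧ → n ∈ ⟦ ⋃ω t ⟧
      ∈⋃ω⁺ k p = char⁺ (k , p)

      ∈⋃ω⁻ : ∀ {t n} → n ∈ ⟦ ⋃ω t ⟧ → ∃[ k ] n ∈ ⟦ t k ⟧
      ∈⋃ω⁻ = char⁻

    Positive : {J : Set} → (J → 𝒫ω) → 𝒫ω → Set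
    Positive {J} set b = ∀ (F : List J) → Infinite λ n → n ∈ ⟦ b ⟧ × ¬ Any (λ j → n ∈ ⟦ set j ⟧) F

    -- `hits` is conditional so that a stage whose target is not positive has an extension as well;
    -- `fresh` is what yields `unique` for later families.
    record Extends {J : Set} (set : J → 𝒫ω) (nodes : J → ℕ → Node κ) (b : ℕ → 𝒫ω)
                   (new : 𝒫ω × (ℕ → Node κ)) : Set where
      private
        a = proj₁ new
        N = proj₂ new
      field
        infinite : a ∈ [ω]^ω
        closed   : ∀ n → Closed W (N n)
        fresh    : ∀ n j m → ¬ (N n ⊑ᴺ nodes j m)
        disjoint : ∀ j → Finite (⟦ a ⟧ ∩ ⟦ set j ⟧)
        guards   : Guards N a
        hits     : (∀ n → Positive set (b n)) → ∃∞ λ n → Infinite (⟦ b n ⟧ ∩ ⟦ a ⟧)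

    -- Adding one member to a family

    module Extend (bounded : Bounded κ) {J : Set} (few : Few J) (family : Family J) where
      open Family family

      -- `avoids` and `guarded` allow arbitrary `t k` inside `Y k` because threads are used twice:
      -- with single points, to find a set inside each `b n`, and with all of `Y`, to form the new
      -- member.
      record Thread (X : Seq) : Set where
        field
          σ        : Node κ
          σ-closed : Closed W σ
          fresh    : ∀ j n → ¬ (σ ⊑ᴺ nodes j n)
          Y        : Seq
          Y⊑X      : Y ⊑ˢ X
          avoids   : ∀ t → (∀ k → ⟦ t k ⟧ ⊆ ⟦ proj₁ Y k ⟧) →
                     ∀ j → (∀ k → Finite (⟦ t k ⟧ ∩ ⟦ set j ⟧)) → Finite (⟦ ⋃ω t ⟧ ∩ ⟦ set j ⟧)
          guarded  : ∀ t → (∀ k → ⟦ t k ⟧ ⊆ ⟦ proj₁ Y k ⟧) →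
                     ∀ (z : 𝒫ω) {η i} → σ η ≡ just i → Finite (⟦ z ⟧ ∩ side i (e η)) →
                     (∀ k → Finite (⟦ z ⟧ ∩ ⟦ t k ⟧)) → Finite (⟦ z ⟧ ∩ ⟦ ⋃ω t ⟧)

      module FreshThread (X : Seq) (X-ad : ∀ j → ∀∞ λ n → Finite (⟦ proj₁ X n ⟧ ∩ ⟦ set j ⟧)) where
        open Tree X

        -- By `node-injective` an old node extends the node of at most one branch. Sending it to
        -- that branch maps `J × ℕ` into `𝔠`, and some branch is missed.
        fresh-branch : ∃[ f ] (∀ j n → ¬ (node f ⊑ᴺ nodes j n))
        fresh-branch = f , λ j n f⊑ → f-new (j , n) (choice-≡ em f⊑)
          where
          choice : ∀ {j n} → Dec (∃[ f ] node f ⊑ᴺ nodes j n) → 𝔠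
          choice (yes (f , _)) = f
          -- An arbitrary value: this old node rules out no branch.
          choice (no _)        = const false
          choice-≡ : ∀ {j n f} (d : Dec (∃[ f ] node f ⊑ᴺ nodes j n)) → node f ⊑ᴺ nodes j n → choice d ≡ f
          choice-≡ (yes (_ , g⊑)) f⊑ = node-injective g⊑ f⊑
          choice-≡ (no none)      f⊑ = contradiction (_ , f⊑) none
          missed = Few-×ℕ few λ (j , n) → choice {j} {n} em
          f = proj₁ missed
          f-new = proj₂ missed

        private
          f = proj₁ fresh-branch
          σ = node f
          D = proj₁ (diagonal f)

        -- Both kinds of obstacle share the index set `κ × ℕ`, so one function handles them all: 0
        -- stands for the wrong side of `e η`, and `suc c` for the old set of code `c` with a node
        -- equal to the restriction of `σ` below `η`.
        obstacle : κ × ℕ → Pred ℕ 0ℓ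
        obstacle (η , zero)  n = ∃[ i ] (σ η ≡ just i × n ∈ side (not i) (e η))
        obstacle (η , suc c) n =
          ∃[ j ] (code j ≡ c × (∃[ m ] nodes j m ≡ restrict W σ η) × n ∈ ⟦ set j ⟧)

        cut = dominate (Bounded-×ℕ bounded) λ l k → ⟦ D k ⟧ ∩ obstacle l

        Y : Seq
        Y = (λ k → char (⟦ D k ⟧ ∩ (proj₁ cut k ≤_))) ,
            λ k → ∃∞-∀∞ (λ p q → char⁺ (p , q)) (proj₂ (diagonal f) k) (proj₁ cut k , λ n le → le)

        Y-avoids : ∀ l → ∀∞ (λ k → Finite (⟦ D k ⟧ ∩ obstacle l)) →
                   ∀∞ λ k → ∀ n → n ∈ ⟦ proj₁ Y k ⟧ → n ∉ obstacle l
        Y-avoids l fin = ∀∞-map (λ beyond n n∈Y n∈l →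
          beyond n (proj₂ (char⁻ n∈Y)) (proj₁ (char⁻ n∈Y) , n∈l)) (proj₂ cut l fin)

        Y-follows : ∀ {η i} → σ η ≡ just i → ∀∞ λ k → ∀ n → n ∈ ⟦ proj₁ Y k ⟧ → n ∉ side (not i) (e η)
        Y-follows {η} {i} eq = ∀∞-map (λ avoid n n∈Y p → avoid n n∈Y (i , eq , p))
          (Y-avoids (η , 0) (∀∞-map (Finite-⊆ (λ (p , j , eq′ , q) → p ,
            subst (λ j → _ ∈ side (not j) (e η)) (just-injective (trans (sym eq′) eq)) q))
            (eventually (diagonal-settles eq))))

        Y-misses : ∀ {j m η} → nodes j m ≡ restrict W σ η → ∀∞ λ k → ∀ n → n ∈ ⟦ proj₁ Y k ⟧ → n ∉ ⟦ set j ⟧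
        Y-misses {j} {m} {η} eq = ∀∞-map (λ avoid n n∈Y p → avoid n n∈Y (j , refl , (m , eq) , p))
          -- By `unique` this obstacle is `set j` alone, which meets almost every term of the
          -- diagonal finitely.
          (Y-avoids (η , suc (code j)) (∀∞-map (Finite-⊆ (λ (p , j′ , ceq , (m′ , eq′) , q) → p ,
            subst (λ j → _ ∈ ⟦ set j ⟧) (unique ceq (trans eq′ (sym eq))) q))
            (∀∞Finite-⊑ˢ (diagonal-⊑ˢ f) (X-ad j))))

        Y⊑diagonal : Y ⊑ˢ diagonal f
        Y⊑diagonal = refines λ k → k , ≤-refl , λ p → proj₁ (char⁻ p)

        module _ (t : ℕ → 𝒫ω) (t⊆Y : ∀ k → ⟦ t k ⟧ ⊆ ⟦ proj₁ Y k ⟧) where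

          -- If a node of `j` is a restriction of `σ`, then `set j` is an obstacle that `Y` was cut
          -- to miss. Otherwise each node of `j` somewhere takes the value opposite to `σ`. As `Y`
          -- follows `σ`, the intersection is almost disjoint from that side, and `guards j` applies
          -- to it.
          Y-avoids-old : ∀ j → (∀ k → Finite (⟦ t k ⟧ ∩ ⟦ set j ⟧)) → Finite (⟦ ⋃ω t ⟧ ∩ ⟦ set j ⟧)
          Y-avoids-old j fin with em {∃[ m ] ∃[ η ] nodes j m ≡ restrict W σ η}
          ... | yes (m , η , eq) = Finite-⊆ (λ (p , q) → let k , n∈t = ∈⋃ω⁻ p in k , n∈t , q)
            (Finite-⋃ (λ k → ⟦ t k ⟧ ∩ ⟦ set j ⟧) fin
              (∀∞-map (λ miss n (n∈t , n∈a) → miss n (t⊆Y _ n∈t) n∈a) (Y-misses eq)))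
          ... | no none = Finite-⊆ (λ (p , q) → char⁺ (p , q) , q) (guards j z diverge)
            where
            z : 𝒫ω
            z = char (⟦ ⋃ω t ⟧ ∩ ⟦ set j ⟧)
            diverge : ∀ m → ∃[ η ] ∃[ i ] (nodes j m η ≡ just i × Finite (⟦ z ⟧ ∩ side i (e η)))
            diverge m with compare W (node-closed f) (closed j m) (proj₂ fresh-branch j m)
            ... | inj₂ (η , eq) = contradiction (m , η , eq) none
            ... | inj₁ (η , i , σ≡ , N≡) = η , not i , N≡ , Finite-⊆
              (λ (p , q) → let p₁ , p₂ = char⁻ p ; k , n∈t = ∈⋃ω⁻ p₁ in k , (n∈t , p₂) , q)
              (Finite-⋃ (λ k → (⟦ t k ⟧ ∩ ⟦ set j ⟧) ∩ side (not i) (e η))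
                (λ k → Finite-⊆ proj₁ (fin k))
                (∀∞-map (λ follow n ((n∈t , _) , q) → follow n (t⊆Y _ n∈t) q) (Y-follows σ≡)))

          -- Off side `i` only finitely many `t k` have any points, and each of them meets `z`
          -- finitely.
          Y-guarded : ∀ (z : 𝒫ω) {η i} → σ η ≡ just i → Finite (⟦ z ⟧ ∩ side i (e η)) →
                      (∀ k → Finite (⟦ z ⟧ ∩ ⟦ t k ⟧)) → Finite (⟦ z ⟧ ∩ ⟦ ⋃ω t ⟧)
          Y-guarded z {η} {i} eq z-fin fin = Finite-∪ cover z-fin
            (Finite-⋃ (λ k → (⟦ z ⟧ ∩ ⟦ t k ⟧) ∩ side (not i) (e η)) (λ k → Finite-⊆ proj₁ (fin k))
              (∀∞-map (λ follow n ((_ , n∈t) , q) → follow n (t⊆Y _ n∈t) q) (Y-follows eq)))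
            where
            cover : ∀ n → n ∈ ⟦ z ⟧ ∩ ⟦ ⋃ω t ⟧ →
                    n ∈ ⟦ z ⟧ ∩ side i (e η) ⊎ ∃[ k ] n ∈ (⟦ z ⟧ ∩ ⟦ t k ⟧) ∩ side (not i) (e η)
            cover n (n∈z , p) with side-total i (e η) n | ∈⋃ω⁻ p
            ... | inj₁ q | _ = inj₁ (n∈z , q)
            ... | inj₂ q | k , n∈t = inj₂ (k , (n∈z , n∈t) , q)

        opaque
          thread : Thread X
          thread = record
            { σ = σ ; σ-closed = node-closed f ; fresh = proj₂ fresh-branch
            ; Y = Y ; Y⊑X = ⊑ˢ-trans Y⊑diagonal (diagonal-⊑ˢ f)
            ; avoids = Y-avoids-old ; guarded = Y-guarded }

      record Strand (b : 𝒫ω) : Set where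
        field
          x        : 𝒫ω
          x-inf    : x ∈ [ω]^ω
          x⊆b      : ⟦ x ⟧ ⊆ ⟦ b ⟧
          ρ        : Node κ
          ρ-closed : Closed W ρ
          fresh    : ∀ j n → ¬ (ρ ⊑ᴺ nodes j n)
          avoids   : ∀ j → Finite (⟦ x ⟧ ∩ ⟦ set j ⟧)
          guarded  : ∀ (z : 𝒫ω) {η i} → ρ η ≡ just i → Finite (⟦ z ⟧ ∩ side i (e η)) →
                     Finite (⟦ z ⟧ ∩ ⟦ x ⟧)

      module _ (b : 𝒫ω) (b⁺ : Positive set b) where

        AlmostDisjointPieces : Set
        AlmostDisjointPieces = Σ[ X ∈ Seq ] ((∀ n → ⟦ proj₁ X n ⟧ ⊆ ⟦ b ⟧) ×
          (∀ j → ∀∞ λ n → Finite (⟦ proj₁ X n ⟧ ∩ ⟦ set j ⟧)))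

        -- Removing the sets in `F` from `b` leaves a set almost disjoint from every member,
        -- infinite by positivity; it is repeated forever.
        finitely-many-meet : ∀ F → (∀ j → ¬ (j ∈ˡ F) → Finite (⟦ b ⟧ ∩ ⟦ set j ⟧)) → AlmostDisjointPieces
        finitely-many-meet F fin =
          ((λ _ → rest) , λ _ → ∃∞-map char⁺ (b⁺ F)) , (λ _ p → proj₁ (char⁻ p)) , λ j → 0 , λ _ _ → rest-fin j
          where
          rest : 𝒫ω
          rest = char λ n → n ∈ ⟦ b ⟧ × ¬ Any (λ j → n ∈ ⟦ set j ⟧) F
          rest-fin : ∀ j → Finite (⟦ rest ⟧ ∩ ⟦ set j ⟧)
          rest-fin j with em {j ∈ˡ F}
          ... | yes j∈F = Finite-∅ λ n (p , q) → proj₂ (char⁻ p) (lose j∈F q)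
          ... | no  j∉F = Finite-⊆ (λ (p , q) → proj₁ (char⁻ p) , q) (fin j j∉F)

        -- The pieces are the traces on `b` of distinct members, so a given member meets at most one
        -- of them, its own, infinitely.
        infinitely-many-meet : (∀ F → ∃[ j ] (¬ (j ∈ˡ F) × Infinite (⟦ b ⟧ ∩ ⟦ set j ⟧))) → AlmostDisjointPieces
        infinitely-many-meet pick =
          ((λ n → char (⟦ b ⟧ ∩ ⟦ set (index n) ⟧)) , λ n → ∃∞-map char⁺ (proj₂ (proj₂ (pick (before n))))) ,
          (λ _ p → proj₁ (char⁻ p)) , ad
          where
          before : ℕ → List J
          before zero    = []
          before (suc n) = proj₁ (pick (before n)) ∷ before n
          index : ℕ → J
          index n = proj₁ (pick (before n))
          earlier : ∀ {m n} → suc m ≤ n → index m ∈ˡ before n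
          earlier {m} {suc n} (s≤s m≤n) with m≤n⇒m<n∨m≡n m≤n
          ... | inj₁ m<n  = there (earlier m<n)
          ... | inj₂ refl = here refl
          meets-finitely : ∀ {n j} → index n ≢ j → Finite (⟦ char (⟦ b ⟧ ∩ ⟦ set (index n) ⟧) ⟧ ∩ ⟦ set j ⟧)
          meets-finitely ne = Finite-⊆ (λ (p , q) → proj₂ (char⁻ p) , q) (disjoint ne)
          ad : ∀ j → ∀∞ λ n → Finite (⟦ char (⟦ b ⟧ ∩ ⟦ set (index n) ⟧) ⟧ ∩ ⟦ set j ⟧)
          ad j with em {∃[ m ] index m ≡ j}
          ... | yes (m , refl) = suc m , λ n m<n → meets-finitely λ eq →
                  proj₁ (proj₂ (pick (before n))) (subst (_∈ˡ before n) (sym eq) (earlier m<n))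
          ... | no none = 0 , λ n _ → meets-finitely λ eq → none (n , eq)

        pieces : AlmostDisjointPieces
        pieces with em {∃[ F ] (∀ j → ¬ (j ∈ˡ F) → Finite (⟦ b ⟧ ∩ ⟦ set j ⟧))}
        ... | yes (F , fin) = finitely-many-meet F fin
        ... | no none = infinitely-many-meet λ F → by-contradiction λ ¬pick → none
                (F , λ j j∉F → ¬Infinite⇒Finite λ inf → ¬pick (j , j∉F , inf))

        opaque
          strand : Strand b
          strand = record
            { x = ⋃ω t
            ; x-inf = λ m → r m , proj₁ (proj₂ (proj₂ Y m m)) , ∈⋃ω⁺ m (char⁺ refl)
            ; x⊆b = λ p → let k , n∈t = ∈⋃ω⁻ {t} p ; m , _ , Y⊆X = refine Y⊑X k
                          in proj₁ (proj₂ pieces) m (Y⊆X (t⊆Y k n∈t))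
            ; ρ = σ ; ρ-closed = σ-closed ; fresh = fresh
            ; avoids = λ j → avoids t t⊆Y j λ k → Finite-⊆ proj₁ (t-fin k)
            ; guarded = λ z eq fin → guarded t t⊆Y z eq fin λ k → Finite-⊆ proj₂ (t-fin k)
            }
            where
            open Thread (FreshThread.thread (proj₁ pieces) (proj₂ (proj₂ pieces)))
            r : ℕ → ℕ
            -- A point of `Y k` that is at least `k`, which makes the union infinite. As each `t k`
            -- is finite, the finiteness premises of `avoids` and `guarded` come for free.
            r k = proj₁ (proj₂ Y k k)
            t : ℕ → 𝒫ω
            t k = char (_≡ r k)
            t-fin : ∀ k → Finite ⟦ t k ⟧
            t-fin k = suc (r k) , λ n p → s≤s (≤-reflexive (char⁻ p))
            t⊆Y : ∀ k → ⟦ t k ⟧ ⊆ ⟦ proj₁ Y k ⟧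
            t⊆Y k p = subst (T ∘ proj₁ Y k) (sym (char⁻ p)) (proj₂ (proj₂ (proj₂ Y k k)))

      extension : (b : ℕ → 𝒫ω) → (∀ n → Positive set (b n)) → ∃ (Extends set nodes b)
      extension b b⁺ = (a , N) , record
        { infinite = λ m → let n , m≤n , n∈Y = proj₂ Y 0 m in n , m≤n , ∈⋃ω⁺ 0 n∈Y
        ; closed = λ { zero → σ-closed ; (suc n) → Strand.ρ-closed (S n) }
        ; fresh = λ { zero → fresh ; (suc n) → Strand.fresh (S n) }
        ; disjoint = λ j → avoids (proj₁ Y) (λ _ p → p) j (λ k → let m , _ , Y⊆X = refine Y⊑X k in
            Finite-⊆ (λ (p , q) → Y⊆X p , q) (Strand.avoids (S m) j))
        -- The node of the thread reduces the claim to single terms `Y k`; each lies in one strand,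
        -- whose own node handles it. The shift in `h (suc m)` makes room for `σ` at 0.
        ; guards = λ z h → let _ , _ , eq , fin = h 0 in
            guarded (proj₁ Y) (λ _ p → p) z eq fin λ k →
              let m , _ , Y⊆X = refine Y⊑X k ; _ , _ , eq′ , fin′ = h (suc m) in
              Finite-⊆ (λ (p , q) → p , Y⊆X q) (Strand.guarded (S m) z eq′ fin′)
        -- `Y k` is infinite and lies both in `a` and in `b m` for some `m ≥ k`.
        ; hits = λ _ k → let m , k≤m , Y⊆X = refine Y⊑X k in
            m , k≤m , ∃∞-map (λ p → Strand.x⊆b (S m) (Y⊆X p) , ∈⋃ω⁺ k p) (proj₂ Y k)
        }
        where
        S : ∀ n → Strand (b n)
        S n = strand (b n) (b⁺ n)
        open Thread (FreshThread.thread ((λ n → Strand.x (S n)) , λ n → Strand.x-inf (S n))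
                            (λ j → 0 , λ n _ → Strand.avoids (S n) j))
        a = ⋃ω (proj₁ Y)
        N : ℕ → Node κ
        N zero    = σ
        N (suc n) = Strand.ρ (S n)

    -- The transfinite recursion

    module Construction (bounded : Bounded κ) {D : Set} (WD : WellOrder D)
                        (initial-few : ∀ δ → Few (Σ[ ξ ∈ D ] T (WellOrder.↓ WD δ ξ)))
                        (targets : D → ℕ → 𝒫ω) where
      open WellOrder WD using () renaming (_≺ʷ_ to _≺ᴰ_; wf to wfᴰ; tri to triᴰ)

      Member : Set
      Member = 𝒫ω × (ℕ → Node κ)

      column : ℕ → 𝒫ω
      column m = char λ k → proj₁ (unpair k) ≡ m

      column-infinite : ∀ m → column m ∈ [ω]^ω
      column-infinite m i = pair m i , pair-≥ m i , char⁺ (cong proj₁ (unpair-pair m i))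

      column-disjoint : ∀ {m m′} → m ≢ m′ → Finite (⟦ column m ⟧ ∩ ⟦ column m′ ⟧)
      column-disjoint m≢m′ = Finite-∅ λ n (p , q) → m≢m′ (trans (sym (char⁻ p)) (char⁻ q))

      -- The columns make every stage infinite, so that ω itself is always positive.
      set-at : {I : Set} → (I → Member) → ℕ ⊎ I → 𝒫ω
      set-at prev (inj₁ m) = column m
      set-at prev (inj₂ ξ) = proj₁ (prev ξ)

      nodes-at : {I : Set} → (I → Member) → ℕ ⊎ I → ℕ → Node κ
      -- The empty node decides nothing, so the guard condition of a column is vacuous.
      nodes-at prev (inj₁ m) = λ _ _ → nothing
      nodes-at prev (inj₂ ξ) = proj₂ (prev ξ)

      Before : D → Set
      Before δ = Σ[ ξ ∈ D ] ξ ≺ᴰ δ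

      ExtendsAt : (δ : D) → (Before δ → Member) → Member → Set
      ExtendsAt δ prev = Extends (set-at prev) (nodes-at prev) (targets δ)

      try : ∀ {δ prev} → Dec (∃ (ExtendsAt δ prev)) → Member
      try (yes (o , _)) = o
      -- A placeholder: by `good-step` an extension exists whenever all earlier members are good.
      try (no _)        = const false , λ _ _ → nothing

      try-extends : ∀ {δ prev} (d : Dec (∃ (ExtendsAt δ prev))) → ∃ (ExtendsAt δ prev) → ExtendsAt δ prev (try d)
      try-extends (yes (_ , ok)) _      = ok
      try-extends (no none)      exists = contradiction exists none

      build : ∀ δ → Acc _≺ᴰ_ δ → Member
      build δ (acc rs) = try {δ} {λ (ξ , ξ≺δ) → build ξ (rs ξ≺δ)} em

      -- Needed for the recursion equation `member-unfold`, where accessibility proofs from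
      -- different sources meet.
      build-irrelevant : ∀ δ p q → build δ p ≡ build δ q
      build-irrelevant δ (acc rs) (acc rs′) = cong (λ prev → try {δ} {prev} em)
        (ext λ (ξ , ξ≺δ) → build-irrelevant ξ (rs ξ≺δ) (rs′ ξ≺δ))

      member : D → Member
      member δ = build δ (wfᴰ δ)

      earlier : ∀ δ → Before δ → Member
      earlier δ (ξ , _) = member ξ

      member-unfold : ∀ δ → member δ ≡ try {δ} {earlier δ} em
      member-unfold δ = go (wfᴰ δ)
        where
        go : ∀ p → build δ p ≡ try {δ} {earlier δ} em
        go (acc rs) = cong (λ prev → try {δ} {prev} em)
          (ext λ (ξ , ξ≺δ) → build-irrelevant ξ (rs ξ≺δ) (wfᴰ ξ))

      Good : D → Set
      Good δ = ExtendsAt δ (earlier δ) (member δ)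

      members-disjoint : ∀ {ξ ξ′} → Good ξ → Good ξ′ → ξ ≢ ξ′ →
                         Finite (⟦ proj₁ (member ξ) ⟧ ∩ ⟦ proj₁ (member ξ′) ⟧)
      members-disjoint {ξ} {ξ′} good good′ ξ≢ξ′ with triᴰ ξ ξ′
      ... | inj₁ lt        = Finite-⊆ (λ (p , q) → q , p) (Extends.disjoint good′ (inj₂ (ξ , lt)))
      ... | inj₂ (inj₁ eq) = contradiction eq ξ≢ξ′
      ... | inj₂ (inj₂ gt) = Extends.disjoint good (inj₂ (ξ′ , gt))

      -- The parameter `index` lets this serve both the members before a stage and the whole family.
      sets-disjoint : {I : Set} (index : I → D) → (∀ {ξ ξ′} → index ξ ≡ index ξ′ → ξ ≡ ξ′) →
                      (∀ ξ → Good (index ξ)) → ∀ {j j′} → j ≢ j′ →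
                      Finite (⟦ set-at (member ∘ index) j ⟧ ∩ ⟦ set-at (member ∘ index) j′ ⟧)
      sets-disjoint index inj good {inj₁ m} {inj₁ m′} ne = column-disjoint (ne ∘ cong inj₁)
      sets-disjoint index inj good {inj₁ m} {inj₂ ξ}  ne =
        Finite-⊆ (λ (p , q) → q , p) (Extends.disjoint (good ξ) (inj₁ m))
      sets-disjoint index inj good {inj₂ ξ} {inj₁ m}  ne = Extends.disjoint (good ξ) (inj₁ m)
      sets-disjoint index inj good {inj₂ ξ} {inj₂ ξ′} ne =
        members-disjoint (good ξ) (good ξ′) (ne ∘ cong inj₂ ∘ inj)

      before-≡ : ∀ {δ} {p q : Before δ} → proj₁ p ≡ proj₁ q → p ≡ q
      before-≡ {p = ξ , lt} {_ , lt′} refl = cong (ξ ,_) (T-irrelevant lt lt′)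

      family-before : ∀ δ → (∀ ξ → ξ ≺ᴰ δ → Good ξ) → Family (ℕ ⊎ Before δ)
      family-before δ good = record
        { set = set-at (earlier δ)
        ; nodes = nodes-at (earlier δ)
        ; code = code
        ; closed = λ { (inj₁ m) n _ () ; (inj₂ (ξ , lt)) → Extends.closed (good ξ lt) }
        ; guards = λ { (inj₁ m) z h → contradiction (proj₁ (proj₂ (proj₂ (h 0)))) λ ()
                     ; (inj₂ (ξ , lt)) → Extends.guards (good ξ lt) }
        ; disjoint = sets-disjoint proj₁ before-≡ λ (ξ , lt) → good ξ lt
        ; unique = unique
        }
        where
        -- All columns share the empty node, hence their distinct codes. The other members may share
        -- one code, since by `fresh` a later one has no node in common with an earlier one.
        code : ℕ ⊎ Before δ → ℕ
        code (inj₁ m) = suc m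
        code (inj₂ _) = 0
        unique : ∀ {j j′ n n′} → code j ≡ code j′ → nodes-at (earlier δ) j n ≡ nodes-at (earlier δ) j′ n′ → j ≡ j′
        unique {inj₁ m} {inj₁ m′} c _ = cong inj₁ (suc-injective c)
        unique {inj₂ (ξ , lt)} {inj₂ (ξ′ , lt′)} {n} {n′} _ eq with triᴰ ξ ξ′
        ... | inj₁ ξ≺ξ′ = contradiction (λ η i e → trans (cong (λ N → N η) eq) e)
                (Extends.fresh (good ξ′ lt′) n′ (inj₂ (ξ , ξ≺ξ′)) n)
        ... | inj₂ (inj₁ same) = cong inj₂ (before-≡ same)
        ... | inj₂ (inj₂ ξ′≺ξ) = contradiction (λ η i e → trans (cong (λ N → N η) (sym eq)) e)
                (Extends.fresh (good ξ lt) n (inj₂ (ξ′ , ξ′≺ξ)) n′)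

      finite-meet-⋃ : ∀ {J : Set} (set : J → 𝒫ω) {Q : Pred ℕ 0ℓ} F → (∀ j → j ∈ˡ F → Finite (Q ∩ ⟦ set j ⟧)) →
                      Finite (Q ∩ λ n → Any (λ j → n ∈ ⟦ set j ⟧) F)
      finite-meet-⋃ set []      fin = Finite-∅ λ { _ (_ , ()) }
      finite-meet-⋃ set (j ∷ F) fin = Finite-∪
        (λ { n (q , here p) → inj₁ (q , p) ; n (q , there p) → inj₂ (q , p) })
        (fin j (here refl)) (finite-meet-⋃ set F λ j j∈F → fin j (there j∈F))

      unused-column : {I : Set} (F : List (ℕ ⊎ I)) → ∀∞ λ m → ¬ (inj₁ m ∈ˡ F)
      unused-column []           = 0 , λ _ _ ()
      unused-column (inj₁ m ∷ F) = ∀∞-zip (λ { m<m′ _ (here refl) → <-irrefl refl m<m′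
                                             ; _ unused (there p) → unused p })
                                          (suc m , λ _ lt → lt) (unused-column F)
      unused-column (inj₂ _ ∷ F) = ∀∞-map (λ { unused (there p) → unused p }) (unused-column F)

      -- A column not listed in `F` is infinite and almost disjoint from the union of the sets in
      -- `F`.
      ω-positive : ∀ δ → (∀ ξ → ξ ≺ᴰ δ → Good ξ) → Positive (set-at (earlier δ)) (const true)
      ω-positive δ good F with unused-column F
      ... | m , unused = Infinite-∖ (λ _ ¬any → _ , ¬any) (column-infinite m)
        (finite-meet-⋃ (set-at (earlier δ)) F λ j j∈F → Family.disjoint (family-before δ good)
          {inj₁ m} λ eq → unused m ≤-refl (subst (_∈ˡ F) (sym eq) j∈F))

      good-step : ∀ δ → (∀ ξ → ξ ≺ᴰ δ → Good ξ) → ∃ (ExtendsAt δ (earlier δ))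
      good-step δ good = extend em
        where
        module Ext = Extend bounded (Few-⊎ Few-ℕ (initial-few δ)) (family-before δ good)
        extend : Dec (∀ n → Positive (set-at (earlier δ)) (targets δ n)) → ∃ (ExtendsAt δ (earlier δ))
        extend (yes pos) = Ext.extension (targets δ) pos
        -- When the target is not positive, the constant sequence ω replaces it and `hits` holds
        -- vacuously.
        extend (no ¬pos) = let new , ok = Ext.extension (λ _ → const true) λ _ → ω-positive δ good in
          new , record { Extends ok hiding (hits) ; hits = λ pos → contradiction pos ¬pos }

      all-good : ∀ δ → Good δ
      all-good δ = go (wfᴰ δ)
        where
        go : ∀ {δ} → Acc _≺ᴰ_ δ → Good δ
        go {δ} (acc rs) = subst (ExtendsAt δ (earlier δ)) (sym (member-unfold δ))
          (try-extends em (good-step δ λ ξ ξ≺δ → go (rs ξ≺δ)))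

      set : ℕ ⊎ D → 𝒫ω
      set = set-at member

      set-infinite : ∀ j → set j ∈ [ω]^ω
      set-infinite (inj₁ m) = column-infinite m
      set-infinite (inj₂ δ) = Extends.infinite (all-good δ)

      set-disjoint : ∀ {j j′} → j ≢ j′ → Finite (⟦ set j ⟧ ∩ ⟦ set j′ ⟧)
      set-disjoint {j} {j′} = sets-disjoint id id all-good {j} {j′}

      set-injective : ∀ {j j′} → set j ≡ set j′ → j ≡ j′
      set-injective {j} {j′} eq = by-contradiction λ ne → Finite⇒¬Infinite
        (set-disjoint {j} {j′} ne) (∃∞-map (λ p → p , subst (λ x → _ ∈ ⟦ x ⟧) eq p) (set-infinite j))

      𝒜 : Pred 𝒫ω 0ℓ
      𝒜 x = ∃[ j ] set j ≡ x

      -- The sets before `δ` belong to `𝒜`, so they generate no larger an ideal.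
      positive : ∀ δ b → b ∉ 𝓘 𝒜 → Positive (set-at (earlier δ)) b
      positive δ b b∉𝓘 F = ¬Finite⇒Infinite λ fin → b∉𝓘
        (map (set-at (earlier δ)) F , all F , Finite-⊆ (λ (p , q) → p , q ∘ map⁺) fin)
        where
        member-of-𝒜 : ∀ j → set-at (earlier δ) j ∈ 𝒜
        member-of-𝒜 (inj₁ m)       = inj₁ m , refl
        member-of-𝒜 (inj₂ (ξ , _)) = inj₂ ξ , refl
        all : ∀ F → All (_∈ 𝒜) (map (set-at (earlier δ)) F)
        all []      = []
        all (j ∷ F) = member-of-𝒜 j ∷ all F

      weaklyTight : (∀ b → ∃[ δ ] targets δ ≡ b) → WeaklyTight 𝒜
      weaklyTight targets-onto =
        (λ { (j , refl) → set-infinite j }) ,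
        (λ { _ _ (j , refl) (j′ , refl) ne → set-disjoint {j} {j′} (ne ∘ cong set) }) ,
        hit
        where
        hit : ∀ (b : ℕ → 𝒫ω) → (∀ n → b n ∉ 𝓘 𝒜) → ∃[ a ] (a ∈ 𝒜 × ∃∞ λ n → Infinite (⟦ b n ⟧ ∩ ⟦ a ⟧))
        hit b b∉𝓘 with targets-onto b
        ... | δ , refl = set (inj₂ δ) , (inj₂ δ , refl) ,
                         Extends.hits (all-good δ) λ n → positive δ (b n) (b∉𝓘 n)

  -- The Cantor-Bernstein theorem

  module _ {A B : Set} (f : A → B) (g : B → A)
           (f-injective : Injective _≡_ _≡_ f) (g-injective : Injective _≡_ _≡_ g) where

    -- The points reached from outside the range of `g` by iterating `g ∘ f`. The bijection is `f`
    -- on them and the inverse of `g` elsewhere.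
    data Orbit : A → Set where
      start  : ∀ {a} → (∀ b → g b ≢ a) → Orbit a
      onward : ∀ {a} → Orbit a → Orbit (g (f a))

    cantor-bernstein : Σ[ h ∈ (A → B) ] (Injective _≡_ _≡_ h × (∀ b → ∃[ a ] h a ≡ b))
    cantor-bernstein = (λ a → h a em) , (λ {a} {a′} → injective a a′ em em) ,
                       λ b → let a , eq = surjective b em in a , eq em
      where
      preimage : ∀ {a} → ¬ Orbit a → ∃[ b ] g b ≡ a
      preimage ¬o = by-contradiction λ none → ¬o (start λ b eq → none (b , eq))
      h : ∀ a → Dec (Orbit a) → B
      h a (yes _) = f a
      h a (no ¬o) = proj₁ (preimage ¬o)
      injective : ∀ a a′ d d′ → h a d ≡ h a′ d′ → a ≡ a′
      injective a a′ (yes _) (yes _) eq = f-injective eq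
      injective a a′ (no ¬o) (no ¬o′) eq =
        trans (sym (proj₂ (preimage ¬o))) (trans (cong g eq) (proj₂ (preimage ¬o′)))
      injective a a′ (yes o) (no ¬o′) eq =
        contradiction (subst Orbit (trans (cong g eq) (proj₂ (preimage ¬o′))) (onward o)) ¬o′
      injective a a′ (no ¬o) (yes o′) eq =
        contradiction (subst Orbit (trans (cong g (sym eq)) (proj₂ (preimage ¬o))) (onward o′)) ¬o
      h-yes : ∀ {a} → Orbit a → ∀ d → h a d ≡ f a
      h-yes o (yes _) = refl
      h-yes o (no ¬o) = contradiction o ¬o
      in-orbit : ∀ {a b} → Orbit a → g b ≡ a → ∃[ a′ ] (Orbit a′ × f a′ ≡ b)
      in-orbit (start outside) eq = contradiction eq (outside _)
      in-orbit (onward o)      eq = _ , o , g-injective (sym eq)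
      surjective : ∀ b → Dec (Orbit (g b)) → ∃[ a ] (∀ d → h a d ≡ b)
      surjective b (yes o) with in-orbit o refl
      ... | a , o′ , eq = a , λ d → trans (h-yes o′ d) eq
      surjective b (no ¬o) = g b , unique
        where
        unique : ∀ d → h (g b) d ≡ b
        unique (yes o)  = contradiction o ¬o
        unique (no ¬o′) = g-injective (proj₂ (preimage ¬o′))

  -- An enumeration of 𝔠 with short initial segments

  record Enumeration : Set₁ where
    field
      D           : Set
      order       : WellOrder D
      initial-few : ∀ δ → Few (Σ[ ξ ∈ D ] T (WellOrder.↓ order δ ξ))
      value       : D → 𝔠
      onto        : ∀ y → ∃[ δ ] value δ ≡ y

  -- If some initial segment of a well-order of 𝔠 maps onto 𝔠, the least such
  -- segment serves; otherwise the whole order does.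
  enumeration : Enumeration
  enumeration with em {∃[ x ] ¬ Few (Σ[ y ∈ 𝔠 ] T (WellOrder.↓ (Zermelo.wellOrder 𝔠) x y))}
  ... | no none = record
    { D = 𝔠 ; order = Zermelo.wellOrder 𝔠
    ; initial-few = λ δ → by-contradiction λ ¬few → none (δ , ¬few)
    ; value = id ; onto = λ y → y , refl }
  ... | yes some with least (Zermelo.wellOrder 𝔠) _ some
  ...   | x , ¬few , minimal = record
    { D = Σ[ y ∈ 𝔠 ] y ≺ʷ x
    ; order = record
      { ↓ = λ (y , _) (z , _) → ↓ y z
      ; wf = λ (y , lt) → restrict-acc (wf y) lt
      ; trans≺ = trans≺
      ; tri = tri′
      }
    -- The segment below `y` is the same in both orders up to membership proofs, and it is few by
    -- minimality of `x`.
    ; initial-few = λ (y , y≺x) φ →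
        let w , miss = by-contradiction (minimal y y≺x) λ (z , z≺y) → φ ((z , trans≺ z≺y y≺x) , z≺y)
        in w , λ ((z , z≺x) , z≺y) eq → miss (z , z≺y)
             (trans (cong (λ p → φ ((z , p) , z≺y)) (T-irrelevant _ _)) eq)
    ; value = proj₁ (¬∀⇒∃¬ ¬few)
    ; onto = λ y → by-contradiction λ none → proj₂ (¬∀⇒∃¬ ¬few) (y , λ m eq → none (m , eq))
    }
    where
    open WellOrder (Zermelo.wellOrder 𝔠)
    restrict-acc : ∀ {y} → Acc _≺ʷ_ y → (lt : y ≺ʷ x) →
                   Acc (λ (p q : Σ[ y ∈ 𝔠 ] y ≺ʷ x) → proj₁ p ≺ʷ proj₁ q) (y , lt)
    restrict-acc (acc rs) _ = acc λ {(z , lt)} z≺y → restrict-acc (rs z≺y) lt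
    tri′ : ∀ (p q : Σ[ y ∈ 𝔠 ] y ≺ʷ x) → proj₁ p ≺ʷ proj₁ q ⊎ p ≡ q ⊎ proj₁ q ≺ʷ proj₁ p
    tri′ (y , y≺x) (z , z≺x) with tri y z
    ... | inj₁ y≺z         = inj₁ y≺z
    ... | inj₂ (inj₁ refl) = inj₂ (inj₁ (cong (y ,_) (T-irrelevant y≺x z≺x)))
    ... | inj₂ (inj₂ z≺y)  = inj₂ (inj₂ z≺y)

  -- The family of size 𝔠 and the theorem

  sequence : 𝔠 → ℕ → 𝒫ω
  sequence y n i = y (pair n i)

  sequence-onto : ∀ b → ∃[ y ] sequence y ≡ b
  sequence-onto b = (λ k → let n , i = unpair k in b n i) ,
    ext λ n → ext λ i → cong (λ (n , i) → b n i) (unpair-pair n i)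

  weaklyTight-of-size-𝔠 : {κ : Set} (e : κ → 𝒫ω) → Bounded κ → ωω-Splitting e →
                          Σ[ 𝒜 ∈ Pred 𝒫ω 0ℓ ] (WeaklyTight 𝒜 × HasSize 𝒜 𝔠)
  weaklyTight-of-size-𝔠 {κ} e bounded split =
    C.𝒜 ,
    C.weaklyTight (λ b → let y , eq = sequence-onto b ; δ , eq′ = onto y in δ , trans (cong sequence eq′) eq) ,
    C.set ∘ h , h-injective ∘ C.set-injective ,
    λ x → mk⇔ (λ (j , eq) → let α , eq′ = h-onto j in α , trans (cong C.set eq′) eq)
              (λ (α , eq) → h α , eq)
    where
    open Enumeration enumeration
    module C = Branching.Construction (Zermelo.wellOrder κ) e split bounded order initial-few (sequence ∘ value)
    index : 𝔠 → ℕ ⊎ D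
    index y = inj₂ (proj₁ (onto y))
    index-injective : Injective _≡_ _≡_ index
    index-injective {y} {y′} eq =
      trans (sym (proj₂ (onto y))) (trans (cong value (inj₂-injective eq)) (proj₂ (onto y′)))
    -- `C.set` maps back into `𝔠`, since `𝒫ω` and `𝔠` are the same type.
    bijection = cantor-bernstein index C.set index-injective C.set-injective
    h           = proj₁ bijection
    h-injective = proj₁ (proj₂ bijection)
    h-onto      = proj₂ (proj₂ bijection)

theorem13 :
    ExcludedMiddle 0ℓ → Extensionality 0ℓ 0ℓ →
    (𝔰 𝔟 : Set) → Is-𝔰 𝔰 → Is-𝔟 𝔟 → 𝔰 ≺ 𝔟 →
    Is-𝔰ωω 𝔰 × (Σ[ 𝒜 ∈ Pred 𝒫ω 0ℓ ] (WeaklyTight 𝒜 × HasSize 𝒜 𝔠))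
theorem13 em ext 𝔰 𝔟 ((e , e-inf , split) , 𝔰-least) (_ , 𝔟-least) (_ , 𝔟⋠𝔰) =
  ((e , e-inf , ωω-split) , λ ι (e′ , e′-inf , split′) → 𝔰-least ι (e′ , e′-inf , ωω⇒splitting split′)) ,
  weaklyTight-of-size-𝔠 e bounded ωω-split
  where
  open Classical em ext
  bounded : Bounded 𝔰
  -- An unbounded family indexed by `𝔰` would give `𝔟 ≼ 𝔰`.
  bounded f = by-contradiction λ unbounded → 𝔟⋠𝔰 (𝔟-least 𝔰 (f , unbounded))
  ωω-split = Settling.splitting⇒ωω-splitting e bounded split
  ωω⇒splitting : ∀ {ι} {e′ : ι → 𝒫ω} → ωω-Splitting e′ → Splitting e′
  -- For a constant sequence, any one of the infinitely many terms gives the splitting of `b`.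
  ωω⇒splitting split′ b inf with split′ (const b) (const inf)
  ... | α , p , q = α , proj₂ (proj₂ (p 0)) , proj₂ (proj₂ (q 0))
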